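{- Let $T$ be a propositional theory over $\mathcal V$, let $(\mathcal A,\oplus,\otimes,e^\oplus,e^\otimes)$ be a commutative semiring, and let $\alpha:\mathcal L\to\mathcal A$ be a labeling function on the literals of $\mathcal V$. Assume that $\otimes$ is idempotent ($a\otimes a=a$ for all $a\in\mathcal A$) and that $(\otimes,\alpha)$ is consistency-preserving, i.e. $\alpha(v)\otimes\alpha(\neg v)=e^\oplus$ for all $v\in\mathcal V$. If $N_T$ is an sd-NNF representation of $T$ (i.e. an NNF circuit that is smooth and deterministic, is logically equivalent to $T$, and whose set of variables is $\mathcal V$), then evaluating $N_T$ is a sound AMC computation, i.e. $$\mathrm{Eval}(N_T,\oplus,\otimes,e^\oplus,e^\otimes,\alpha)=\mathbf A(T).$$
   Context: A semiring $(\mathcal A,\oplus,\otimes,e^\oplus,e^\otimes)$ has associative binary operations $\oplus,\otimes$ on $\mathcal A$, with $\oplus$ commutative, $\otimes$ distributing over $\oplus$, $e^\oplus$ neutral for $\oplus$, $e^\otimes$ neutral for $\otimes$, and $e^\oplus\otimes a=a\otimes e^\oplus=e^\oplus$ for all $a$. It is commutative if $\otimes$ is also commutative. Algebraic model count: for a propositional theory $T$ over a finite set $\mathcal V$ of variables and $\alpha:\mathcal L\to\mathcal A$ on the set $\mathcal L$ of literals of $\mathcal V$, $$\mathbf A(T)=\bigoplus_{I\in\mathcal M(T)}\ \bigotimes_{l\in I}\alpha(l),$$ where $\mathcal M(T)$ is the set of models of $T$; a model is a set of literals containing exactly one of $v,\neg v$ for each $v\in\mathcal V$. Empty sums are $e^\oplus$,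 empty products $e^\otimes$. An NNF circuit over $\mathcal V$ is a finite rooted directed acyclic graph whose leaves are labeled with $\top$, $\bot$ or a literal of a variable in $\mathcal V$, and whose internal nodes are labeled $\vee$ or $\wedge$. Each node is identified with the formula of the subcircuit rooted at it, and its variables are those occurring in that subcircuit. The circuit is deterministic if for each disjunction node $\bigvee_{i=1}^n\phi_i$ each two children $\phi_i,\phi_j$ ($i\ne j$) are logically inconsistent; smooth if for each disjunction node all children mention the same set of variables. $\mathrm{Eval}$ is defined recursively from the leaves to the root: $\top\mapsto e^\otimes$, $\bot\mapsto e^\oplus$, literal $l\mapsto\alpha(l)$, a disjunction node $\mapsto$ the $\oplus$-sum of the values of its children, a conjunction node $\mapsto$ the $\otimes$-product of the values of its children; the value of the circuit is that of its root. -}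

module Defs where

open import Algebra.Bundles using (CommutativeSemiring)
open import Data.Bool.Base using (Bool; true; false; not; _∧_; _∨_; if_then_else_)
open import Data.Empty using (⊥)
open import Data.Fin.Base using (Fin)
open import Data.Fin.Induction using (spo-wellFounded)
open import Data.List.Base using (List; []; _∷_; map; foldr; filter; allFin; cartesianProductWith)
open import Data.List.Membership.Propositional using (_∈_; mapWith∈)
open import Data.List.NonEmpty.Base using (List⁺; toList)
open import Data.List.Relation.Unary.Unique.Propositional using (Unique)
open import Data.Nat.Base using (ℕ; zero; suc)
open import Data.Product.Base using (_×_)
open import Data.Sum.Base using (_⊎_)
open import Data.Vec.Base using (Vec; lookup) renaming ([] to []ᵛ; _∷_ to _∷ᵛ_)
open import Function.Bundles using (_⇔_)
open import Induction.WellFounded using (Acc; acc; WellFounded; module Subrelation)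
open import Level using (Level)
open import Relation.Binary.Construct.Closure.ReflexiveTransitive using (Star)
open import Relation.Binary.Construct.Closure.Transitive using (TransClosure; [_]; _++_)
open import Relation.Binary.Core using (Rel)
open import Relation.Binary.PropositionalEquality using (_≡_; _≢_; refl; isEquivalence; resp₂)
open import Relation.Nullary using (¬_)
open import Relation.Unary using (Pred; Decidable)

-- The finite variable set is Fin m throughout.

data Literal (m : ℕ) : Set where
  pos neg : Fin m → Literal m

infix  9 ¬ᶠ_
infixr 8 _∧ᶠ_
infixr 7 _∨ᶠ_
infixr 6 _⇒ᶠ_ _⇔ᶠ_

data Formula (m : ℕ) : Set where
  ⊤ᶠ ⊥ᶠ                     : Formula m
  var                       : Fin m → Formula m
  ¬ᶠ_                       : Formula m → Formula m
  _∧ᶠ_ _∨ᶠ_ _⇒ᶠ_ _⇔ᶠ_       : Formula m → Formula m → Formula m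

literalᶠ : ∀ {m} → Literal m → Formula m
literalᶠ (pos v) = var v
literalᶠ (neg v) = ¬ᶠ var v

⋁ᶠ ⋀ᶠ : ∀ {m} → List (Formula m) → Formula m
⋁ᶠ = foldr _∨ᶠ_ ⊥ᶠ
⋀ᶠ = foldr _∧ᶠ_ ⊤ᶠ

infix 4 _occursIn_

_occursIn_ : ∀ {m} → Fin m → Formula m → Set
v occursIn ⊤ᶠ       = ⊥
v occursIn ⊥ᶠ       = ⊥
v occursIn var w    = v ≡ w
v occursIn ¬ᶠ φ     = v occursIn φ
v occursIn φ ∧ᶠ ψ   = v occursIn φ ⊎ v occursIn ψ
v occursIn φ ∨ᶠ ψ   = v occursIn φ ⊎ v occursIn ψ
v occursIn φ ⇒ᶠ ψ   = v occursIn φ ⊎ v occursIn ψ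
v occursIn φ ⇔ᶠ ψ   = v occursIn φ ⊎ v occursIn ψ

-- A set of literals containing exactly one of v, ¬v for each v, stored as
-- the choice made at each v; `literals` recovers the set itself, each of its
-- elements listed once.
Interpretation : ℕ → Set
Interpretation m = Vec Bool m

literals : ∀ {m} → Interpretation m → List (Literal m)
literals {m} I = map (λ v → if lookup I v then pos v else neg v) (allFin m)

-- Every interpretation, listed exactly once.
interpretations : ∀ m → List (Interpretation m)
interpretations zero    = []ᵛ ∷ []
interpretations (suc m) = cartesianProductWith _∷ᵛ_ (true ∷ false ∷ []) (interpretations m)

⟦_⟧ : ∀ {m} → Formula m → Interpretation m → Bool
⟦ ⊤ᶠ ⟧     I = true
⟦ ⊥ᶠ ⟧     I = false
⟦ var v ⟧  I = lookup I v
⟦ ¬ᶠ φ ⟧   I = not (⟦ φ ⟧ I)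
⟦ φ ∧ᶠ ψ ⟧ I = ⟦ φ ⟧ I ∧ ⟦ ψ ⟧ I
⟦ φ ∨ᶠ ψ ⟧ I = ⟦ φ ⟧ I ∨ ⟦ ψ ⟧ I
⟦ φ ⇒ᶠ ψ ⟧ I = not (⟦ φ ⟧ I) ∨ ⟦ ψ ⟧ I
⟦ φ ⇔ᶠ ψ ⟧ I = if ⟦ φ ⟧ I then ⟦ ψ ⟧ I else not (⟦ ψ ⟧ I)

infix 4 _⊨_

_⊨_ : ∀ {m} → Interpretation m → Formula m → Set
I ⊨ φ = ⟦ φ ⟧ I ≡ true

Inconsistent : ∀ {m} → Formula m → Formula m → Set
Inconsistent φ ψ = ∀ I → ¬ (I ⊨ φ × I ⊨ ψ)

-- A theory is an arbitrary, possibly infinite, set of formulas.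
Theory : ℕ → (t : Level) → Set _
Theory m t = Pred (Formula m) t

Model : ∀ {m t} → Theory m t → Pred (Interpretation m) t
Model T I = ∀ φ → T φ → I ⊨ φ

module _ {c ℓ} (A : CommutativeSemiring c ℓ) where
  open CommutativeSemiring A

  ⨁ ⨂ : List Carrier → Carrier
  ⨁ = foldr _+_ 0#
  ⨂ = foldr _*_ 1#

  ConsistencyPreserving : ∀ {m} → (Literal m → Carrier) → Set ℓ
  ConsistencyPreserving α = ∀ v → α (pos v) * α (neg v) ≈ 0#

  -- Modelhood is always decidable classically; a decision procedure is what
  -- makes the sum over the models computable here.
  AMC : ∀ {m t} (T : Theory m t) → Decidable (Model T) → (Literal m → Carrier) → Carrier
  AMC {m} T model? α =
    ⨁ (map (λ I → ⨂ (map α (literals I))) (filter model? (interpretations m)))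

-- The label of a node, together with its outgoing edges; n is the number of
-- nodes of the graph.
data Gate (m n : ℕ) : Set where
  ⊤ᵍ ⊥ᵍ : Gate m n
  litᵍ  : Literal m → Gate m n
  ⋁ᵍ ⋀ᵍ : List⁺ (Fin n) → Gate m n

children : ∀ {m n} → Gate m n → List (Fin n)
children ⊤ᵍ       = []
children ⊥ᵍ       = []
children (litᵍ _) = []
children (⋁ᵍ is)  = toList is
children (⋀ᵍ is)  = toList is

record Circuit (m : ℕ) : Set where
  field
    size : ℕ
    gate : Fin size → Gate m size
    root : Fin size

  Node : Set
  Node = Fin size

  infix 4 _◁_

  _◁_ : Rel Node _
  j ◁ i = j ∈ children (gate i)

  field
    simple    : ∀ i → Unique (children (gate i))
    acyclic   : ∀ i → ¬ TransClosure _◁_ i i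
    reachable : ∀ i → Star _◁_ i root

  ◁-wellFounded : WellFounded _◁_
  ◁-wellFounded = Subrelation.wellFounded [_] (spo-wellFounded record
    { isEquivalence = isEquivalence
    ; irrefl        = λ { {i} refl i◁⁺i → acyclic i i◁⁺i }
    ; trans         = _++_
    ; <-resp-≈      = resp₂ (TransClosure _◁_)
    })

  -- Recursion from the leaves up to a given node.
  module Recursion {a} {X : Set a}
    (⊤ˣ ⊥ˣ : X) (litˣ : Literal m → X) (⋁ˣ ⋀ˣ : List X → X) where

    step : (g : Gate m size) → (∀ {j} → j ∈ children g → X) → X
    step ⊤ᵍ       rec = ⊤ˣ
    step ⊥ᵍ       rec = ⊥ˣ
    step (litᵍ l) rec = litˣ l
    step (⋁ᵍ is)  rec = ⋁ˣ (mapWith∈ (toList is) rec)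
    step (⋀ᵍ is)  rec = ⋀ˣ (mapWith∈ (toList is) rec)

    foldAcc : ∀ i → Acc _◁_ i → X
    foldAcc i (acc rs) = step (gate i) (λ {j} j◁i → foldAcc j (rs j◁i))

    fold : Node → X
    fold i = foldAcc i (◁-wellFounded i)

  formula : Node → Formula m
  formula = Recursion.fold ⊤ᶠ ⊥ᶠ literalᶠ ⋁ᶠ ⋀ᶠ

  Deterministic : Set
  Deterministic = ∀ i is → gate i ≡ ⋁ᵍ is → ∀ {j k} → j ∈ toList is → k ∈ toList is →
    j ≢ k → Inconsistent (formula j) (formula k)

  Smooth : Set
  Smooth = ∀ i is → gate i ≡ ⋁ᵍ is → ∀ {j k} → j ∈ toList is → k ∈ toList is →
    ∀ v → v occursIn formula j ⇔ v occursIn formula k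

Eval : ∀ {c ℓ m} (A : CommutativeSemiring c ℓ) → Circuit m →
       (Literal m → CommutativeSemiring.Carrier A) → CommutativeSemiring.Carrier A
Eval A N α = Recursion.fold 1# 0# α (⨁ A) (⨂ A) root
  where
  open CommutativeSemiring A
  open Circuit N

record IsSdNNFRepresentation {m t} (N : Circuit m) (T : Theory m t) : Set t where
  open Circuit N
  field
    smooth        : Smooth
    deterministic : Deterministic
    equivalent    : ∀ I → I ⊨ formula root ⇔ Model T I
    allVariables  : ∀ v → v occursIn formula root

{-# OPTIONS --safe #-}
module Submission where

-- Write w(I) for the product of the labels of the literals in I.  Two
-- multiplicative identities hold for the value e of every node φ, both by
-- induction on the circuit:
--
--   (weight-eval)   w(I) * e = w(I) if I satisfies φ, and 0 otherwise;
--   (choice-eval)   (α(v) + α(¬v)) * e = e for every variable v of φ.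
--
-- In the first, idempotence gives w(I) * α(l) = w(I) for l in I, consistency
-- preservation gives w(I) * α(l) = 0 for l not in I, and determinism leaves at
-- most one nonzero summand at a disjunction.  In the second, smoothness makes
-- v occur in every child of a disjunction, while at a conjunction one child in
-- which v occurs suffices; decomposability is never needed.
--
-- Expanding the product of the sums α(v) + α(¬v) over all v gives the sum of
-- all w(I) (expand-⨂).  As every variable occurs at the root, whose value is e,
--
--   e = (⨂ over v of α(v) + α(¬v)) * e = ⨁ over I of w(I) * e
--     = ⨁ over the models I of w(I).

open import Defs
open import Algebra.Bundles using (CommutativeSemiring)
open import Algebra.Definitions using (Idempotent)
open import Data.Bool.Base using (Bool; true; false; _∧_; _∨_; if_then_else_)
open import Data.Bool.Properties using (if-float; ¬-not)
open import Data.Fin.Base using (Fin; zero; suc)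
open import Data.List.Base using (List; []; _∷_; _++_; map; filter; allFin; tabulate)
open import Data.List.Membership.Propositional using (_∈_; find; lose)
open import Data.List.Membership.Propositional.Properties
  using (mapWith∈-cong; mapWith∈≗map; ∈-allFin)
open import Data.List.NonEmpty.Base using (toList)
open import Data.List.Properties using (map-++; map-∘; map-cong; map-tabulate; ++-identityʳ)
open import Data.List.Relation.Unary.All as All using (All; []; _∷_)
import Data.List.Relation.Unary.All.Properties as All
open import Data.List.Relation.Unary.AllPairs using (AllPairs; []; _∷_)
open import Data.List.Relation.Unary.Any as Any using (Any; here; there)
import Data.List.Relation.Unary.Any.Properties as Any
open import Data.Nat.Base using (zero; suc)
open import Data.Product.Base using (_,_)
open import Data.Sum.Base using (inj₁; inj₂)
open import Data.Vec.Base using (lookup) renaming (_∷_ to _∷ᵛ_)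
open import Function.Base using (_∘_)
open import Function.Bundles using (module Equivalence)
open import Induction.WellFounded as WF using (Acc; acc)
open import Relation.Binary.PropositionalEquality as ≡
  using (_≡_; _≢_; refl; cong; cong₂; subst)
open import Relation.Nullary using (does; yes; no; contradiction)
open import Relation.Unary using (Pred; Decidable)

-- Formulas

occursIn-⋁ᶠ : ∀ {m} {v : Fin m} φs → v occursIn ⋁ᶠ φs → Any (v occursIn_) φs
occursIn-⋁ᶠ (φ ∷ φs) (inj₁ v∈φ)  = here v∈φ
occursIn-⋁ᶠ (φ ∷ φs) (inj₂ v∈φs) = there (occursIn-⋁ᶠ φs v∈φs)

occursIn-⋀ᶠ : ∀ {m} {v : Fin m} φs → v occursIn ⋀ᶠ φs → Any (v occursIn_) φs
occursIn-⋀ᶠ (φ ∷ φs) (inj₁ v∈φ)  = here v∈φ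
occursIn-⋀ᶠ (φ ∷ φs) (inj₂ v∈φs) = there (occursIn-⋀ᶠ φs v∈φs)

⊨-⋁ᶠ : ∀ {m} {I : Interpretation m} φs → I ⊨ ⋁ᶠ φs → Any (I ⊨_) φs
⊨-⋁ᶠ {I = I} (φ ∷ φs) I⊨ with ⟦ φ ⟧ I in eq
... | true  = here eq
... | false = there (⊨-⋁ᶠ φs I⊨)

-- Recursion on a circuit

module _ {m} (N : Circuit m) {a} {X : Set a}
  (⊤ˣ ⊥ˣ : X) (litˣ : Literal m → X) (⋁ˣ ⋀ˣ : List X → X) where
  open Circuit N
  open Recursion ⊤ˣ ⊥ˣ litˣ ⋁ˣ ⋀ˣ

  step-cong : ∀ g {rec rec′ : ∀ {j} → j ∈ children g → X} →
              (∀ {j} (j∈ : j ∈ children g) → rec j∈ ≡ rec′ j∈) → step g rec ≡ step g rec′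
  step-cong ⊤ᵍ       eq = refl
  step-cong ⊥ᵍ       eq = refl
  step-cong (litᵍ l) eq = refl
  step-cong (⋁ᵍ is)  eq = cong ⋁ˣ (mapWith∈-cong (toList is) _ _ eq)
  step-cong (⋀ᵍ is)  eq = cong ⋀ˣ (mapWith∈-cong (toList is) _ _ eq)

  -- The value does not depend on the accessibility proof that drives the
  -- recursion, so that fold satisfies its defining equation, fold-unfold.
  foldAcc-irrelevant : ∀ {i} (p q : Acc _◁_ i) → foldAcc i p ≡ foldAcc i q
  foldAcc-irrelevant {i} (acc p) (acc q) =
    step-cong (gate i) (λ j◁i → foldAcc-irrelevant (p j◁i) (q j◁i))

  -- The value at a gate whose children take the values given by f.
  gateValue : (Fin size → X) → Gate m size → X
  gateValue f ⊤ᵍ       = ⊤ˣ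
  gateValue f ⊥ᵍ       = ⊥ˣ
  gateValue f (litᵍ l) = litˣ l
  gateValue f (⋁ᵍ is)  = ⋁ˣ (map f (toList is))
  gateValue f (⋀ᵍ is)  = ⋀ˣ (map f (toList is))

  step≡gateValue : ∀ f g → step g (λ {j} _ → f j) ≡ gateValue f g
  step≡gateValue f ⊤ᵍ       = refl
  step≡gateValue f ⊥ᵍ       = refl
  step≡gateValue f (litᵍ l) = refl
  step≡gateValue f (⋁ᵍ is)  = cong ⋁ˣ (mapWith∈≗map f (toList is))
  step≡gateValue f (⋀ᵍ is)  = cong ⋀ˣ (mapWith∈≗map f (toList is))

  fold-unfold : ∀ i → fold i ≡ gateValue fold (gate i)
  fold-unfold i with ◁-wellFounded i
  ... | acc rs = ≡.trans
    (step-cong (gate i) (λ {j} j◁i → foldAcc-irrelevant (rs j◁i) (◁-wellFounded j)))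
    (step≡gateValue fold (gate i))

-- Sums and products in a commutative semiring

module _ {c ℓ} (A : CommutativeSemiring c ℓ) where
  open CommutativeSemiring A hiding (zero) renaming (refl to ≈-refl)
  open import Relation.Binary.Reasoning.Setoid setoid
  open import Algebra.Properties.CommutativeSemigroup *-commutativeSemigroup
    using (x∙yz≈y∙xz)

  infix 4 _fixes_

  -- Multiplication by x leaves y unchanged.
  _fixes_ : Carrier → Carrier → Set ℓ
  x fixes y = x * y ≈ y

  fixes-⨁ : ∀ {x ys} → All (x fixes_) ys → x fixes ⨁ A ys
  fixes-⨁ []               = zeroʳ _
  fixes-⨁ (x-fixes-y ∷ ps) = trans (distribˡ _ _ _) (+-cong x-fixes-y (fixes-⨁ ps))

  fixes-⨂ : ∀ {x ys} → Any (x fixes_) ys → x fixes ⨂ A ys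
  fixes-⨂ (here x-fixes-y) = trans (sym (*-assoc _ _ _)) (*-congʳ x-fixes-y)
  fixes-⨂ (there p)        = trans (x∙yz≈y∙xz _ _ _) (*-congˡ (fixes-⨂ p))

  ⨂-fixes : ∀ {xs y} → All (_fixes y) xs → ⨂ A xs fixes y
  ⨂-fixes []               = *-identityˡ _
  ⨂-fixes (x-fixes-y ∷ ps) = trans (*-assoc _ _ _) (trans (*-congˡ (⨂-fixes ps)) x-fixes-y)

  infix 8 _when_

  -- The Iverson bracket: x times the truth value b.
  _when_ : Carrier → Bool → Carrier
  x when b = if b then x else 0#

  when-∧ : ∀ {x y z} b c → x * y ≈ x when b → x * z ≈ x when c → x * (y * z) ≈ x when (b ∧ c)
  when-∧ {x} {y} {z} b c xy xz = trans (sym (*-assoc x y z)) (trans (*-congʳ xy) (rest b))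
    where
    rest : ∀ b → (x when b) * z ≈ x when (b ∧ c)
    rest true  = xz
    rest false = zeroˡ z

  ⨁-map-cong : ∀ {j} {J : Set j} {f g : J → Carrier} → (∀ x → f x ≈ g x) →
               ∀ xs → ⨁ A (map f xs) ≈ ⨁ A (map g xs)
  ⨁-map-cong f≈g []       = ≈-refl
  ⨁-map-cong f≈g (x ∷ xs) = +-cong (f≈g x) (⨁-map-cong f≈g xs)

  ⨁-++ : ∀ xs ys → ⨁ A (xs ++ ys) ≈ ⨁ A xs + ⨁ A ys
  ⨁-++ []       ys = sym (+-identityˡ _)
  ⨁-++ (x ∷ xs) ys = trans (+-congˡ (⨁-++ xs ys)) (sym (+-assoc _ _ _))

  ⨁-distribˡ : ∀ {j} {J : Set j} x (f : J → Carrier) js →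
               x * ⨁ A (map f js) ≈ ⨁ A (map (λ j → x * f j) js)
  ⨁-distribˡ x f []       = zeroʳ x
  ⨁-distribˡ x f (j ∷ js) = trans (distribˡ _ _ _) (+-congˡ (⨁-distribˡ x f js))

  ⨁-filter : ∀ {j p} {J : Set j} {P : Pred J p} (P? : Decidable P) (f : J → Carrier) js →
             ⨁ A (map f (filter P? js)) ≈ ⨁ A (map (λ j → f j when does (P? j)) js)
  ⨁-filter P? f []       = ≈-refl
  ⨁-filter P? f (j ∷ js) with does (P? j)
  ... | true  = +-congˡ (⨁-filter P? f js)
  ... | false = trans (⨁-filter P? f js) (sym (+-identityˡ _))

  -- A product of binary sums is the sum, over all ways to choose a summand from
  -- each factor, of the products of the chosen summands.
  expand-⨂ : ∀ {m} (x y : Fin m → Carrier) →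
             ⨂ A (tabulate (λ v → x v + y v)) ≈
             ⨁ A (map (λ I → ⨂ A (tabulate (λ v → if lookup I v then x v else y v)))
                      (interpretations m))
  expand-⨂ {zero}  x y = sym (+-identityʳ 1#)
  expand-⨂ {suc m} x y = begin
    (x zero + y zero) * ⨂ A (tabulate (λ v → x (suc v) + y (suc v)))
      ≈⟨ *-congˡ (expand-⨂ (x ∘ suc) (y ∘ suc)) ⟩
    (x zero + y zero) * ⨁ A (map tail Is)
      ≈⟨ distribʳ _ _ _ ⟩
    x zero * ⨁ A (map tail Is) + y zero * ⨁ A (map tail Is)
      ≈⟨ +-cong (⨁-distribˡ _ tail Is) (⨁-distribˡ _ tail Is) ⟩
    ⨁ A (map (λ I → x zero * tail I) Is) + ⨁ A (map (λ I → y zero * tail I) Is)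
      ≡⟨ cong₂ (λ xs ys → ⨁ A xs + ⨁ A ys) (map-∘ Is) (map-∘ Is) ⟩
    ⨁ A (map full (map (true ∷ᵛ_) Is)) + ⨁ A (map full (map (false ∷ᵛ_) Is))
      ≈⟨ sym (⨁-++ (map full (map (true ∷ᵛ_) Is)) _) ⟩
    ⨁ A (map full (map (true ∷ᵛ_) Is) ++ map full (map (false ∷ᵛ_) Is))
      ≡⟨ cong (⨁ A) (≡.sym (map-++ full (map (true ∷ᵛ_) Is) _)) ⟩
    ⨁ A (map full (map (true ∷ᵛ_) Is ++ map (false ∷ᵛ_) Is))
      ≡⟨ cong (λ Js → ⨁ A (map full (map (true ∷ᵛ_) Is ++ Js))) (≡.sym (++-identityʳ _)) ⟩
    ⨁ A (map full (interpretations (suc m))) ∎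
    where
    Is   = interpretations m
    tail = λ (I : Interpretation m) →
      ⨂ A (tabulate (λ v → if lookup I v then x (suc v) else y (suc v)))
    full = λ (I : Interpretation (suc m)) →
      ⨂ A (tabulate (λ v → if lookup I v then x v else y v))

  -- If w * e(j) is w times the truth value of φ(j) for every j, then so it is
  -- for the sum of the e(j) and the disjunction of the φ(j): the latter being
  -- pairwise inconsistent, at most one summand differs from 0.
  *-⋁ᶠ : ∀ {j m} {J : Set j} (e : J → Carrier) (φ : J → Formula m) {w I} js →
         AllPairs (λ j k → Inconsistent (φ j) (φ k)) js →
         All (λ j → w * e j ≈ w when ⟦ φ j ⟧ I) js →
         w * ⨁ A (map e js) ≈ w when ⟦ ⋁ᶠ (map φ js) ⟧ I
  *-⋁ᶠ e φ {w} []       []       []       = zeroʳ w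
  *-⋁ᶠ e φ {w} {I} (j ∷ js) (d ∷ ds) (p ∷ ps) = begin
    w * (e j + ⨁ A (map e js))                           ≈⟨ distribˡ _ _ _ ⟩
    w * e j + w * ⨁ A (map e js)                         ≈⟨ +-cong p (*-⋁ᶠ e φ js ds ps) ⟩
    w when ⟦ φ j ⟧ I + w when ⟦ ⋁ᶠ (map φ js) ⟧ I        ≈⟨ disjoint-+ _ _ disjoint ⟩
    w when (⟦ φ j ⟧ I ∨ ⟦ ⋁ᶠ (map φ js) ⟧ I)             ∎
    where
    disjoint : I ⊨ φ j → ⟦ ⋁ᶠ (map φ js) ⟧ I ≢ true
    disjoint I⊨φ I⊨⋁ = All.All¬⇒¬Any
      (All.map (λ inc I⊨ψ → inc I (I⊨φ , I⊨ψ)) d) (Any.map⁻ (⊨-⋁ᶠ (map φ js) I⊨⋁))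

    disjoint-+ : ∀ b c → (b ≡ true → c ≢ true) → w when b + w when c ≈ w when (b ∨ c)
    disjoint-+ false c     _    = +-identityˡ _
    disjoint-+ true  false _    = +-identityʳ _
    disjoint-+ true  true  excl = contradiction refl (excl refl)

  -- The same for the product and the conjunction, without inconsistency.
  *-⋀ᶠ : ∀ {j m} {J : Set j} (e : J → Carrier) (φ : J → Formula m) {w I} js →
         All (λ j → w * e j ≈ w when ⟦ φ j ⟧ I) js →
         w * ⨂ A (map e js) ≈ w when ⟦ ⋀ᶠ (map φ js) ⟧ I
  *-⋀ᶠ e φ {w} []       []       = *-identityʳ w
  *-⋀ᶠ e φ     (j ∷ js) (p ∷ ps) = when-∧ _ _ p (*-⋀ᶠ e φ js ps)

  -- Products with the weight of an interpretation

  module _ {m} (α : Literal m → Carrier) where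

    -- The product of the labels of the literals in I.
    weight : Interpretation m → Carrier
    weight I = ⨂ A (map α (literals I))

    choice-⨂ : ⨂ A (tabulate (λ v → α (pos v) + α (neg v))) ≈
               ⨁ A (map weight (interpretations m))
    choice-⨂ = trans (expand-⨂ (α ∘ pos) (α ∘ neg))
                     (⨁-map-cong (λ I → reflexive (cong (⨂ A) (labels I))) (interpretations m))
      where
      labels : ∀ I → tabulate (λ v → if lookup I v then α (pos v) else α (neg v)) ≡
                     map α (literals I)
      labels I = ≡.trans
        (≡.sym (map-tabulate _ _))
        (≡.trans (map-cong (λ v → ≡.sym (if-float α (lookup I v))) (allFin m))
                 (map-∘ (allFin m)))

    module _ (*-idem : Idempotent _≈_ _*_) (consistent : ConsistencyPreserving A α) where

      -- The literal l belongs to I, so that α l is one of the factors of weight I.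
      weight-∈ : ∀ {I v l} → (if lookup I v then pos v else neg v) ≡ l → weight I * α l ≈ weight I
      weight-∈ {I} {v} {l} eq = trans (*-comm _ _) (fixes-⨂ (Any.map⁺ (Any.map⁺
        (Any.map (λ { refl → subst (λ k → α l fixes α k) (≡.sym eq) (*-idem (α l)) })
                 (∈-allFin v)))))

      -- The factor α k of weight I annihilates α l.
      weight-∉ : ∀ {I v k l} → (if lookup I v then pos v else neg v) ≡ k →
                 α k * α l ≈ 0# → weight I * α l ≈ 0#
      weight-∉ {I} {v} {k} {l} eq kl≈0 = begin
        weight I * α l         ≈⟨ *-congʳ (sym (weight-∈ {I} {v} eq)) ⟩
        weight I * α k * α l   ≈⟨ *-assoc _ _ _ ⟩
        weight I * (α k * α l) ≈⟨ *-congˡ kl≈0 ⟩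
        weight I * 0#          ≈⟨ zeroʳ _ ⟩
        0#                     ∎

      weight-literal : ∀ I l → weight I * α l ≈ weight I when ⟦ literalᶠ l ⟧ I
      weight-literal I (pos v) with lookup I v in eq
      ... | true  = weight-∈ {I} {v} (cong (if_then pos v else neg v) eq)
      ... | false = weight-∉ {I} {v} (cong (if_then pos v else neg v) eq)
                                     (trans (*-comm _ _) (consistent v))
      weight-literal I (neg v) with lookup I v in eq
      ... | true  = weight-∉ {I} {v} (cong (if_then pos v else neg v) eq) (consistent v)
      ... | false = weight-∈ {I} {v} (cong (if_then pos v else neg v) eq)

      choice-literal : ∀ {v} l → v occursIn literalᶠ l → (α (pos v) + α (neg v)) fixes α l
      choice-literal (pos v) refl = begin
        (α (pos v) + α (neg v)) * α (pos v)           ≈⟨ distribʳ _ _ _ ⟩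
        α (pos v) * α (pos v) + α (neg v) * α (pos v) ≈⟨ +-cong (*-idem _) (*-comm _ _) ⟩
        α (pos v) + α (pos v) * α (neg v)             ≈⟨ +-congˡ (consistent v) ⟩
        α (pos v) + 0#                                ≈⟨ +-identityʳ _ ⟩
        α (pos v)                                     ∎
      choice-literal (neg v) refl = begin
        (α (pos v) + α (neg v)) * α (neg v)           ≈⟨ distribʳ _ _ _ ⟩
        α (pos v) * α (neg v) + α (neg v) * α (neg v) ≈⟨ +-cong (consistent v) (*-idem _) ⟩
        0# + α (neg v)                                ≈⟨ +-identityˡ _ ⟩
        α (neg v)                                     ∎

      -- The two identities for circuits

      module _ (N : Circuit m) where
        open Circuit N

        -- The value of the subcircuit rooted at a node.
        eval : Node → Carrier
        eval = Recursion.fold 1# 0# α (⨁ A) (⨂ A)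

        eval-unfold : ∀ i → eval i ≡ gateValue N 1# 0# α (⨁ A) (⨂ A) eval (gate i)
        eval-unfold = fold-unfold N 1# 0# α (⨁ A) (⨂ A)

        formula-unfold : ∀ i → formula i ≡ gateValue N ⊤ᶠ ⊥ᶠ literalᶠ ⋁ᶠ ⋀ᶠ formula (gate i)
        formula-unfold = fold-unfold N ⊤ᶠ ⊥ᶠ literalᶠ ⋁ᶠ ⋀ᶠ

        -- Distinctness of the children turns determinism, which concerns
        -- distinct nodes, into a property of distinct positions in the list.
        children-inconsistent : Deterministic → ∀ i is → gate i ≡ ⋁ᵍ is →
          AllPairs (λ j k → Inconsistent (formula j) (formula k)) (toList is)
        children-inconsistent det i is eq =
          pairs (toList is) (subst (λ g → AllPairs _≢_ (children g)) eq (simple i))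
                (det i is eq)
          where
          pairs : ∀ js → AllPairs _≢_ js →
            (∀ {j k} → j ∈ js → k ∈ js → j ≢ k → Inconsistent (formula j) (formula k)) →
            AllPairs (λ j k → Inconsistent (formula j) (formula k)) js
          pairs []       []           inc = []
          pairs (j ∷ js) (j≢ ∷ uniq) inc =
            All.tabulate (λ k∈ → inc (here refl) (there k∈) (All.lookup j≢ k∈)) ∷
            pairs js uniq (λ j∈ k∈ → inc (there j∈) (there k∈))

        weight-eval : Deterministic → ∀ I i → weight I * eval i ≈ weight I when ⟦ formula i ⟧ I
        weight-eval det I = WF.All.wfRec ◁-wellFounded _ _ go
          where
          go : ∀ i → (∀ {j} → j ◁ i → weight I * eval j ≈ weight I when ⟦ formula j ⟧ I) →
               weight I * eval i ≈ weight I when ⟦ formula i ⟧ I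
          go i ih rewrite eval-unfold i | formula-unfold i with gate i in eq
          ... | ⊤ᵍ     = *-identityʳ _
          ... | ⊥ᵍ     = zeroʳ _
          ... | litᵍ l = weight-literal I l
          ... | ⋁ᵍ is  = *-⋁ᶠ eval formula (toList is)
                           (children-inconsistent det i is eq) (All.tabulate ih)
          ... | ⋀ᵍ is  = *-⋀ᶠ eval formula (toList is) (All.tabulate ih)

        choice-eval : Smooth → ∀ v i → v occursIn formula i →
                      (α (pos v) + α (neg v)) fixes eval i
        choice-eval smooth v = WF.All.wfRec ◁-wellFounded _ _ go
          where
          E = α (pos v) + α (neg v)
          go : ∀ i → (∀ {j} → j ◁ i → v occursIn formula j → E fixes eval j) →
               v occursIn formula i → E fixes eval i
          go i ih v∈i rewrite eval-unfold i | formula-unfold i with gate i in eq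
          ... | litᵍ l = choice-literal l v∈i
          ... | ⋁ᵍ is
            using (k , k∈ , v∈k) ← find (Any.map⁻ (occursIn-⋁ᶠ (map formula (toList is)) v∈i))
            = fixes-⨁ (All.map⁺ (All.tabulate
                (λ j∈ → ih j∈ (Equivalence.to (smooth i is eq k∈ j∈ v) v∈k))))
          ... | ⋀ᵍ is
            using (k , k∈ , v∈k) ← find (Any.map⁻ (occursIn-⋀ᶠ (map formula (toList is)) v∈i))
            = fixes-⨂ (Any.map⁺ (lose k∈ (ih k∈ v∈k)))

theorem6 : ∀ {c ℓ t m} (T : Theory m t) (model? : Decidable (Model T)) (A : CommutativeSemiring c ℓ) →
    let open CommutativeSemiring A in
    (α : Literal m → Carrier) →
    Idempotent _≈_ _*_ →
    ConsistencyPreserving A α →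
    (N : Circuit m) → IsSdNNFRepresentation N T →
    Eval A N α ≈ AMC A T model? α
theorem6 T model? A α *-idem consistent N rep = begin
    e
      ≈⟨ sym (⨂-fixes A (All.tabulate⁺ (λ v →
           choice-eval A α *-idem consistent N smooth v root (allVariables v)))) ⟩
    ⨂ A (tabulate (λ v → α (pos v) + α (neg v))) * e
      ≈⟨ *-congʳ (choice-⨂ A α) ⟩
    ⨁ A (map w (interpretations _)) * e
      ≈⟨ *-comm _ _ ⟩
    e * ⨁ A (map w (interpretations _))
      ≈⟨ ⨁-distribˡ A e w (interpretations _) ⟩
    ⨁ A (map (λ I → e * w I) (interpretations _))
      ≈⟨ ⨁-map-cong A e*w (interpretations _) ⟩
    ⨁ A (map (λ I → _when_ A (w I) (does (model? I))) (interpretations _))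
      ≈⟨ sym (⨁-filter A model? w (interpretations _)) ⟩
    AMC A T model? α ∎
  where
  open CommutativeSemiring A hiding (zero) renaming (refl to ≈-refl)
  open import Relation.Binary.Reasoning.Setoid setoid
  open Circuit N
  open IsSdNNFRepresentation rep

  w = weight A α
  e = Eval A N α

  sat≡model : ∀ I → ⟦ formula root ⟧ I ≡ does (model? I)
  sat≡model I with model? I
  ... | yes I∈M = Equivalence.from (equivalent I) I∈M
  ... | no  I∉M = ¬-not (I∉M ∘ Equivalence.to (equivalent I))

  e*w : ∀ I → e * w I ≈ _when_ A (w I) (does (model? I))
  e*w I = trans (*-comm _ _) (trans (weight-eval A α *-idem consistent N deterministic I root)
    (reflexive (cong (_when_ A (w I)) (sat≡model I))))
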